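{- For any integers $m,n\ge3$ and any $p\in(0,1)$, \[ \tilde r(m,n;p)\le\min\{f(K_m,p),f(K_n,1-p)\}\le 3\,\tilde r(m,n;p). \]
   Context: The $(m,n)$-online Ramsey game is played on an infinite set of initially isolated vertices: each turn, Builder places an edge between two nonadjacent vertices and Painter immediately paints it red or blue; Builder wins once there is a red $K_m$ or a blue $K_n$. For $p\in(0,1)$, $\tilde r(m,n;p)$ is the number of turns Builder needs to win this game with probability at least $\frac12$ (i.e. the minimum $N$ such that some Builder strategy wins within $N$ turns with probability at least $\frac12$) against a Painter who independently paints each edge red with probability $p$ and blue with probability $1-p$. In the Subgraph Query Game with parameter $p\in(0,1)$, Builder plays alone on the random graph $G(\mathbb Z,p)$ with infinitely many vertices, whose edges are initially hidden. At each turn Builder queries (adaptively) one pair of vertices and is told whether it is an edge; equivalently, each queried edge is built successfully, independently, with probability $p$, and each pair may be queried at most once. For a graph $H$, $f(H,p)$ is the minimum, over all Builder strategies, of the number of turns needed to build a copy of $H$ with probability at least $\frac12$. -}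

module Defs where

open import Axiom.ExcludedMiddle using (ExcludedMiddle)
open import Data.Bool.Base using (Bool; true; false; if_then_else_)
open import Data.Bool.Properties using (_≟_)
open import Data.Fin.Base using (Fin)
import Data.Integer.Base as ℤ
open import Data.Integer.Base using (ℤ)
open import Data.List.Base as List using (List; []; _∷_; _++_; foldr)
open import Data.List.Membership.Propositional using (_∉_)
open import Data.List.Relation.Unary.Any using (Any)
open import Data.Nat.Base as ℕ using (ℕ; zero; suc)
import Data.Nat.Properties as ℕ
open import Data.Product.Base using (∃-syntax; Σ-syntax; _×_; _,_; proj₁; proj₂)
open import Data.Rational as ℚ using (ℚ; 0ℚ; 1ℚ; ½; ∣_∣; 1/_)
import Data.Rational.Properties as ℚ
open import Data.Rational.Solver using (module +-*-Solver)
open import Data.Sum.Base using (_⊎_)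
open import Data.Vec.Base using (Vec; []; _∷_)
open import Function.Definitions using (Injective)
open import Level using (0ℓ)
open import Relation.Binary.Definitions using (Symmetric; Irreflexive)
open import Relation.Binary.PropositionalEquality
open import Relation.Nullary.Decidable.Core using (does)

-- Real numbers are Cauchy sequences of rationals; sequences with the same limit
-- are not identified, but _≤ℝ_ and _<ℝ_ do not distinguish them.

IsCauchy : (ℕ → ℚ) → Set
IsCauchy x = ∀ ε → 0ℚ ℚ.< ε →
  ∃[ N ] ∀ i j → N ℕ.≤ i → N ℕ.≤ j → ∣ x i ℚ.- x j ∣ ℚ.< ε

record ℝ : Set where
  constructor mkℝ
  field
    seq    : ℕ → ℚ
    cauchy : IsCauchy seq

open ℝ public

infix 4 _≤ℝ_ _<ℝ_

_≤ℝ_ : ℝ → ℝ → Set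
x ≤ℝ y = ∀ ε → 0ℚ ℚ.< ε →
  ∃[ N ] ∀ k → N ℕ.≤ k → seq x k ℚ.≤ seq y k ℚ.+ ε

_<ℝ_ : ℝ → ℝ → Set
x <ℝ y = ∃[ ε ] 0ℚ ℚ.< ε ×
  (∃[ N ] ∀ k → N ℕ.≤ k → seq x k ℚ.+ ε ℚ.≤ seq y k)

fromℚ : ℚ → ℝ
fromℚ q = mkℝ (λ _ → q) λ ε 0<ε → 0 , λ _ _ _ _ →
  subst (λ r → ∣ r ∣ ℚ.< ε) (sym (ℚ.+-inverseʳ q)) 0<ε

0ℝ 1ℝ ½ℝ : ℝ
0ℝ = fromℚ 0ℚ
1ℝ = fromℚ 1ℚ
½ℝ = fromℚ ½

private
  half : ℚ → ℚ
  half ε = ½ ℚ.* ε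

  0<half : ∀ {ε} → 0ℚ ℚ.< ε → 0ℚ ℚ.< half ε
  0<half {ε} 0<ε = ℚ.*-monoʳ-<-pos ½ 0<ε

  half+half : ∀ ε → half ε ℚ.+ half ε ≡ ε
  half+half ε = trans (sym (ℚ.*-distribʳ-+ ε ½ ½)) (ℚ.*-identityˡ ε)

  +-cauchy : ∀ {x y} → IsCauchy x → IsCauchy y → IsCauchy (λ k → x k ℚ.+ y k)
  +-cauchy {x} {y} cx cy ε 0<ε
    with cx (half ε) (0<half 0<ε) | cy (half ε) (0<half 0<ε)
  ... | M , hx | N , hy = M ℕ.⊔ N , λ i j Ki Kj → begin-strict
      ∣ (x i ℚ.+ y i) ℚ.- (x j ℚ.+ y j) ∣
        ≡⟨ cong ∣_∣ (rearrange (x i) (y i) (x j) (y j)) ⟩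
      ∣ (x i ℚ.- x j) ℚ.+ (y i ℚ.- y j) ∣
        ≤⟨ ℚ.∣p+q∣≤∣p∣+∣q∣ (x i ℚ.- x j) (y i ℚ.- y j) ⟩
      ∣ x i ℚ.- x j ∣ ℚ.+ ∣ y i ℚ.- y j ∣
        <⟨ ℚ.+-mono-< (hx i j (ℕ.m⊔n≤o⇒m≤o M N Ki) (ℕ.m⊔n≤o⇒m≤o M N Kj))
                      (hy i j (ℕ.m⊔n≤o⇒n≤o M N Ki) (ℕ.m⊔n≤o⇒n≤o M N Kj)) ⟩
      half ε ℚ.+ half ε
        ≡⟨ half+half ε ⟩
      ε ∎
    where
    open ℚ.≤-Reasoning
    open +-*-Solver
    rearrange : ∀ a b c d →
      (a ℚ.+ b) ℚ.- (c ℚ.+ d) ≡ (a ℚ.- c) ℚ.+ (b ℚ.- d)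
    rearrange = solve 4 (λ a b c d →
      (a :+ b) :- (c :+ d) := (a :- c) :+ (b :- d)) refl

  neg-cauchy : ∀ {x} → IsCauchy x → IsCauchy (λ k → ℚ.- x k)
  neg-cauchy {x} cx ε 0<ε with cx ε 0<ε
  ... | N , hx = N , λ i j Ni Nj →
    subst (ℚ._< ε)
      (trans (sym (ℚ.∣-p∣≡∣p∣ (x i ℚ.- x j))) (cong ∣_∣ (rearrange (x i) (x j))))
      (hx i j Ni Nj)
    where
    open +-*-Solver
    rearrange : ∀ a b → ℚ.- (a ℚ.- b) ≡ (ℚ.- a) ℚ.- (ℚ.- b)
    rearrange = solve 2 (λ a b → :- (a :- b) := (:- a) :- (:- b)) refl

  eventually-bounded : ∀ {x} → IsCauchy x →
    ∃[ B ] ℚ.Positive B × (∃[ N ] ∀ k → N ℕ.≤ k → ∣ x k ∣ ℚ.≤ B)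
  eventually-bounded {x} cx with cx 1ℚ (ℚ.positive⁻¹ 1ℚ)
  ... | N , hx = 1ℚ ℚ.+ ∣ x N ∣ ,
      ℚ.pos+nonNeg⇒pos 1ℚ ∣ x N ∣ {{ℚ.nonNegative (ℚ.0≤∣p∣ (x N))}} ,
      N , λ k Nk → begin
        ∣ x k ∣                        ≡⟨ cong ∣_∣ (split (x k) (x N)) ⟩
        ∣ (x k ℚ.- x N) ℚ.+ x N ∣      ≤⟨ ℚ.∣p+q∣≤∣p∣+∣q∣ (x k ℚ.- x N) (x N) ⟩
        ∣ x k ℚ.- x N ∣ ℚ.+ ∣ x N ∣
          ≤⟨ ℚ.+-monoˡ-≤ ∣ x N ∣ (ℚ.<⇒≤ (hx k N Nk ℕ.≤-refl)) ⟩
        1ℚ ℚ.+ ∣ x N ∣                 ∎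
    where
    open ℚ.≤-Reasoning
    open +-*-Solver
    split : ∀ a b → a ≡ (a ℚ.- b) ℚ.+ b
    split = solve 2 (λ a b → a := (a :- b) :+ b) refl

  bounded*small : ∀ {B} .{{_ : ℚ.Positive B}} a d {δ} →
    ∣ a ∣ ℚ.≤ B → ∣ d ∣ ℚ.< δ → ∣ a ℚ.* d ∣ ℚ.< B ℚ.* δ
  bounded*small {B} a d {δ} a≤B d<δ = begin-strict
    ∣ a ℚ.* d ∣      ≡⟨ ℚ.∣p*q∣≡∣p∣*∣q∣ a d ⟩
    ∣ a ∣ ℚ.* ∣ d ∣
      ≤⟨ ℚ.*-monoʳ-≤-nonNeg ∣ d ∣ {{ℚ.nonNegative (ℚ.0≤∣p∣ d)}} a≤B ⟩
    B ℚ.* ∣ d ∣      <⟨ ℚ.*-monoʳ-<-pos B d<δ ⟩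
    B ℚ.* δ          ∎
    where open ℚ.≤-Reasoning

  divide : ∀ B → ℚ.Positive B → ∀ ε → 0ℚ ℚ.< ε →
    ∃[ δ ] 0ℚ ℚ.< δ × B ℚ.* δ ≡ ε
  divide B B>0 ε 0<ε = δ , ℚ.positive⁻¹ δ {{δ>0}} ,
      trans (sym (ℚ.*-assoc B (1/ B) ε))
        (trans (cong (ℚ._* ε) (ℚ.*-inverseʳ B)) (ℚ.*-identityˡ ε))
    where
    instance _ = B>0
    instance _ = ℚ.pos⇒nonZero B
    δ = (1/ B) ℚ.* ε
    δ>0 : ℚ.Positive δ
    δ>0 = ℚ.pos*pos⇒pos (1/ B) {{ℚ.1/pos⇒pos B}} ε {{ℚ.positive 0<ε}}

  *-difference : ∀ {A B} → ℚ.Positive A → ℚ.Positive B →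
    ∀ a b c d {α β} → ∣ a ∣ ℚ.≤ A → ∣ d ∣ ℚ.≤ B →
    ∣ b ℚ.- d ∣ ℚ.< α → ∣ a ℚ.- c ∣ ℚ.< β →
    ∣ a ℚ.* b ℚ.- c ℚ.* d ∣ ℚ.< A ℚ.* α ℚ.+ B ℚ.* β
  *-difference {A} {B} A>0 B>0 a b c d {α} {β} a≤A d≤B b-d a-c = begin-strict
    ∣ a ℚ.* b ℚ.- c ℚ.* d ∣
      ≡⟨ cong ∣_∣ (rearrange a b c d) ⟩
    ∣ a ℚ.* (b ℚ.- d) ℚ.+ d ℚ.* (a ℚ.- c) ∣
      ≤⟨ ℚ.∣p+q∣≤∣p∣+∣q∣ (a ℚ.* (b ℚ.- d)) (d ℚ.* (a ℚ.- c)) ⟩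
    ∣ a ℚ.* (b ℚ.- d) ∣ ℚ.+ ∣ d ℚ.* (a ℚ.- c) ∣
      <⟨ ℚ.+-mono-< (bounded*small {{A>0}} a (b ℚ.- d) a≤A b-d)
                    (bounded*small {{B>0}} d (a ℚ.- c) d≤B a-c) ⟩
    A ℚ.* α ℚ.+ B ℚ.* β ∎
    where
    open ℚ.≤-Reasoning
    open +-*-Solver
    rearrange : ∀ a b c d →
      a ℚ.* b ℚ.- c ℚ.* d ≡ a ℚ.* (b ℚ.- d) ℚ.+ d ℚ.* (a ℚ.- c)
    rearrange = solve 4 (λ a b c d →
      a :* b :- c :* d := a :* (b :- d) :+ d :* (a :- c)) refl

  *-cauchy : ∀ {x y} → IsCauchy x → IsCauchy y → IsCauchy (λ k → x k ℚ.* y k)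
  *-cauchy {x} {y} cx cy ε 0<ε =
    let A , A>0 , Nᵃ , hA = eventually-bounded cx
        B , B>0 , Nᵇ , hB = eventually-bounded cy
        α , 0<α , Aα≡     = divide A A>0 (half ε) (0<half 0<ε)
        β , 0<β , Bβ≡     = divide B B>0 (half ε) (0<half 0<ε)
        Nʸ , hy           = cy α 0<α
        Nˣ , hx           = cx β 0<β
        L                 = Nᵃ ℕ.⊔ Nᵇ
        R                 = Nʸ ℕ.⊔ Nˣ
        l = λ {k} (h : L ℕ.⊔ R ℕ.≤ k) → ℕ.m⊔n≤o⇒m≤o L R h
        r = λ {k} (h : L ℕ.⊔ R ℕ.≤ k) → ℕ.m⊔n≤o⇒n≤o L R h
    in L ℕ.⊔ R , λ i j Ki Kj →
      subst (∣ x i ℚ.* y i ℚ.- x j ℚ.* y j ∣ ℚ.<_)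
        (trans (cong₂ ℚ._+_ Aα≡ Bβ≡) (half+half ε))
        (*-difference A>0 B>0 (x i) (y i) (x j) (y j)
          (hA i (ℕ.m⊔n≤o⇒m≤o Nᵃ Nᵇ (l Ki)))
          (hB j (ℕ.m⊔n≤o⇒n≤o Nᵃ Nᵇ (l Kj)))
          (hy i j (ℕ.m⊔n≤o⇒m≤o Nʸ Nˣ (r Ki)) (ℕ.m⊔n≤o⇒m≤o Nʸ Nˣ (r Kj)))
          (hx i j (ℕ.m⊔n≤o⇒n≤o Nʸ Nˣ (r Ki)) (ℕ.m⊔n≤o⇒n≤o Nʸ Nˣ (r Kj))))

infixl 6 _+ℝ_ _-ℝ_
infixl 7 _*ℝ_

_+ℝ_ : ℝ → ℝ → ℝ
x +ℝ y = mkℝ (λ k → seq x k ℚ.+ seq y k)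
  (+-cauchy {seq x} {seq y} (cauchy x) (cauchy y))

-ℝ_ : ℝ → ℝ
-ℝ x = mkℝ (λ k → ℚ.- seq x k) (neg-cauchy {seq x} (cauchy x))

_-ℝ_ : ℝ → ℝ → ℝ
x -ℝ y = x +ℝ (-ℝ y)

_*ℝ_ : ℝ → ℝ → ℝ
x *ℝ y = mkℝ (λ k → seq x k ℚ.* seq y k)
  (*-cauchy {seq x} {seq y} (cauchy x) (cauchy y))

sumℝ : List ℝ → ℝ
sumℝ = foldr _+ℝ_ 0ℝ

record SimpleGraph : Set₁ where
  field
    order    : ℕ
    _~_      : Fin order → Fin order → Set
    ~-sym    : Symmetric _~_
    ~-irrefl : Irreflexive _≡_ _~_

K : ℕ → SimpleGraph
K n = record
  { order = n ; _~_ = _≢_ ; ~-sym = ≢-sym ; ~-irrefl = λ i≡j i≢j → i≢j i≡j }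

-- Both games are played on the vertex set ℤ.  An unordered pair of distinct
-- vertices is stored with its smaller endpoint first.

record Pair : Set where
  constructor pair
  field
    lo hi  : ℤ
    .lo<hi : lo ℤ.< hi

Joins : ℤ → ℤ → Pair → Set
Joins u v e = (lo ≡ u × hi ≡ v) ⊎ (lo ≡ v × hi ≡ u)
  where open Pair e

-- A copy need not be induced.

ContainsCopy : SimpleGraph → List Pair → Set
ContainsCopy H es =
  ∃[ φ ] Injective {A = Fin order} {B = ℤ} _≡_ _≡_ φ ×
    (∀ i j → i ~ j → Any (Joins (φ i) (φ j)) es)
  where open SimpleGraph H

-- Builder's strategy for the next N turns, given the pairs already used: a
-- fresh pair for each turn, depending on the outcomes of the earlier turns.

data Strategy (used : List Pair) : ℕ → Set where
  done : Strategy used zero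
  turn : ∀ {N} (e : Pair) → e ∉ used →
         (Bool → Strategy (e ∷ used) N) → Strategy used (suc N)

play : ∀ {used N} → Strategy used N → Vec Bool N → List (Pair × Bool)
play done           []      = []
play (turn e _ cont) (b ∷ ω) = (e , b) ∷ play (cont b) ω

outcomes : ∀ N → List (Vec Bool N)
outcomes zero    = [] ∷ []
outcomes (suc N) =
  List.map (true ∷_) (outcomes N) ++ List.map (false ∷_) (outcomes N)

weight : ∀ {N} → ℝ → Vec Bool N → ℝ
weight p []      = 1ℝ
weight p (b ∷ ω) = (if b then p else 1ℝ -ℝ p) *ℝ weight p ω

withOutcome : Bool → List (Pair × Bool) → List Pair
withOutcome b board = List.map proj₁ (List.filter (λ x → b ≟ proj₂ x) board)

record IsMinimum (P : ℕ → Set) (N : ℕ) : Set where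
  field
    attained : P N
    least    : ∀ {k} → P k → N ℕ.≤ k

-- Excluded middle is needed for indicator functions of events, and for the
-- minima below to exist: Pr … ≥ ½ is not decidable for a Cauchy real p.

module Games (em : ExcludedMiddle 0ℓ) where

  𝟙 : Set → ℝ
  𝟙 A = if does (em {A}) then 1ℝ else 0ℝ

  Pr : ∀ {N} → ℝ → (Vec Bool N → Set) → ℝ
  Pr {N} p A = sumℝ (List.map (λ ω → weight p ω *ℝ 𝟙 (A ω)) (outcomes N))

  -- Builder can reach a position satisfying W with probability at least ½.
  -- The goals below persist once reached and the board is infinite, so playing
  -- on for exactly N turns is the same as winning within N turns.

  Achievable : ℝ → (List (Pair × Bool) → Set) → ℕ → Set
  Achievable p W N = Σ[ σ ∈ Strategy [] N ] ½ℝ ≤ℝ Pr p (λ ω → W (play σ ω))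

  -- Outcome true is red, false is blue.

  RamseyWin : ℕ → ℕ → List (Pair × Bool) → Set
  RamseyWin m n board = ContainsCopy (K m) (withOutcome true board)
                      ⊎ ContainsCopy (K n) (withOutcome false board)

  -- Outcome true is a successfully built edge.

  QueryWin : SimpleGraph → List (Pair × Bool) → Set
  QueryWin H board = ContainsCopy H (withOutcome true board)

  -- r̃(m,n;p) = N and f(H,p) = N, as relations determining N uniquely.

  r̃⟨_,_⨾_⟩≡_ : ℕ → ℕ → ℝ → ℕ → Set
  r̃⟨ m , n ⨾ p ⟩≡ N = IsMinimum (Achievable p (RamseyWin m n)) N

  f⟨_,_⟩≡_ : SimpleGraph → ℝ → ℕ → Set
  f⟨ H , p ⟩≡ N = IsMinimum (Achievable p (QueryWin H)) N

{-# OPTIONS --safe #-}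
module Submission where

-- If Builder wins the Ramsey game with probability at least ½, then her strategy
-- builds a red K_m or a blue K_n with probability at least ¼.  Three independent
-- repetitions on disjoint vertex sets raise this to 1 − (3/4)³ = 37/64 > ½, and
-- the room between 37/64 and ½ absorbs the error terms in the comparison of
-- Cauchy reals.  The subgraph query games can be won at all because querying every
-- pair of n vertices succeeds with a positive probability, which repetition
-- amplifies.  Conversely, a strategy for either subgraph query game is a
-- strategy for the Ramsey game, with the colours exchanged in the case of K_n.

open import Defs
open import Axiom.ExcludedMiddle using (ExcludedMiddle)
open import Data.Bool.Base using (Bool; true; false; not; if_then_else_)
open import Data.Bool.Properties using (not-involutive) renaming (_≟_ to _≟ᵇ_)
open import Data.Empty using (⊥-elim)
open import Data.Fin.Base using (Fin; toℕ)
open import Data.Fin.Properties using (toℕ-injective)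
open import Data.Integer.Base as ℤ using (ℤ; +_; +[1+_])
import Data.Integer.Properties as ℤ
open import Data.List.Base as List using (List; []; _∷_; _++_; allFin; cartesianProductWith)
open import Data.List.Membership.Propositional using (_∈_; find; lose)
open import Data.List.Membership.Propositional.Properties
  using (∈-map∘filter⁺; ∈-map∘filter⁻; ∈-allFin; ∈-cartesianProductWith⁺)
open import Data.List.Relation.Unary.Any using (here; there)
open import Data.Nat.Base as ℕ using (ℕ; zero; suc; _≤_; _*_; _+_; _⊓_; _⊔_)
open import Data.Nat.Induction using (<-rec)
import Data.Nat.Properties as ℕ
open import Data.Product.Base using (_×_; _,_; proj₁; proj₂; ∃-syntax; Σ-syntax)
open import Data.Rational as ℚ using (ℚ; mkℚ; 0ℚ; 1ℚ; ½; toℚᵘ)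
import Data.Rational.Properties as ℚ
open import Data.Rational.Solver using (module +-*-Solver)
open import Data.Rational.Unnormalised.Base as ℚᵘ using (mkℚᵘ; *≡*; *≤*)
import Data.Rational.Unnormalised.Properties as ℚᵘ
open import Data.Sum.Base using (_⊎_; inj₁; inj₂; [_,_]′)
open import Data.Vec.Base as Vec using (Vec; []; _∷_)
import Data.Vec.Properties as Vec
open import Function.Base using (_∘_; id)
open import Level using (0ℓ)
open import Relation.Binary.Definitions using (tri<; tri≈; tri>)
open import Relation.Binary.PropositionalEquality
open import Relation.Nullary using (¬_; yes; no)
open import Relation.Nullary.Decidable using (does; from-yes)
open import Algebra.Definitions.RawSemiring ℚ.+-*-rawSemiring using (_^_) renaming (_×_ to _·_)

-- Rational inequalities

*-monoˡ-≤ : ∀ {r p q} → 0ℚ ℚ.≤ r → p ℚ.≤ q → r ℚ.* p ℚ.≤ r ℚ.* q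
*-monoˡ-≤ {r} 0≤r = ℚ.*-monoˡ-≤-nonNeg r {{ℚ.nonNegative 0≤r}}

*-monoʳ-≤ : ∀ {r p q} → 0ℚ ℚ.≤ r → p ℚ.≤ q → p ℚ.* r ℚ.≤ q ℚ.* r
*-monoʳ-≤ {r} 0≤r = ℚ.*-monoʳ-≤-nonNeg r {{ℚ.nonNegative 0≤r}}

0≤p*q : ∀ {p q} → 0ℚ ℚ.≤ p → 0ℚ ℚ.≤ q → 0ℚ ℚ.≤ p ℚ.* q
0≤p*q {p} {q} 0≤p 0≤q = subst (ℚ._≤ p ℚ.* q) (ℚ.*-zeroʳ p) (*-monoˡ-≤ 0≤p 0≤q)

0<p*q : ∀ {p q} → 0ℚ ℚ.< p → 0ℚ ℚ.< q → 0ℚ ℚ.< p ℚ.* q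
0<p*q {p} {q} 0<p 0<q =
  ℚ.positive⁻¹ (p ℚ.* q) {{ℚ.pos*pos⇒pos p {{ℚ.positive 0<p}} q {{ℚ.positive 0<q}}}}

0≤p^n : ∀ {p} n → 0ℚ ℚ.≤ p → 0ℚ ℚ.≤ p ^ n
0≤p^n zero    0≤p = from-yes (0ℚ ℚ.≤? 1ℚ)
0≤p^n (suc n) 0≤p = 0≤p*q 0≤p (0≤p^n n 0≤p)

0<p^n : ∀ {p} n → 0ℚ ℚ.< p → 0ℚ ℚ.< p ^ n
0<p^n zero    0<p = from-yes (0ℚ ℚ.<? 1ℚ)
0<p^n (suc n) 0<p = 0<p*q 0<p (0<p^n n 0<p)

1-1-p : ∀ p → 1ℚ ℚ.- (1ℚ ℚ.- p) ≡ p
1-1-p = solve 1 (λ p → con 1ℚ :- (con 1ℚ :- p) := p) refl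
  where open +-*-Solver

complement-antimono : ∀ {p q} → p ℚ.≤ q → 1ℚ ℚ.- q ℚ.≤ 1ℚ ℚ.- p
complement-antimono p≤q = ℚ.+-monoʳ-≤ 1ℚ (ℚ.neg-antimono-≤ p≤q)

1-p≤½⇒½≤p : ∀ {p} → 1ℚ ℚ.- p ℚ.≤ ½ → ½ ℚ.≤ p
1-p≤½⇒½≤p {p} 1-p≤½ = subst (½ ℚ.≤_) (1-1-p p) (complement-antimono {1ℚ ℚ.- p} {½} 1-p≤½)

p≤p+q : ∀ {p q} → 0ℚ ℚ.≤ q → p ℚ.≤ p ℚ.+ q
p≤p+q {p} {q} 0≤q = subst (ℚ._≤ p ℚ.+ q) (ℚ.+-identityʳ p) (ℚ.+-monoʳ-≤ p 0≤q)

p≤∣p∣ : ∀ p → p ℚ.≤ ℚ.∣ p ∣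
p≤∣p∣ p with ℚ.≤-total 0ℚ p
... | inj₁ 0≤p = ℚ.≤-reflexive (sym (ℚ.0≤p⇒∣p∣≡p 0≤p))
... | inj₂ p≤0 = ℚ.≤-trans p≤0 (ℚ.0≤∣p∣ p)

∣p-q∣<r⇒p≤q+r : ∀ {p q r} → ℚ.∣ p ℚ.- q ∣ ℚ.< r → p ℚ.≤ q ℚ.+ r
∣p-q∣<r⇒p≤q+r {p} {q} {r} h = begin
  p                    ≡⟨ solve 2 (λ p q → p := q :+ (p :- q)) refl p q ⟩
  q ℚ.+ (p ℚ.- q)      ≤⟨ ℚ.+-monoʳ-≤ q (ℚ.≤-trans (p≤∣p∣ _) (ℚ.<⇒≤ h)) ⟩
  q ℚ.+ r              ∎
  where
  open ℚ.≤-Reasoning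
  open +-*-Solver

p≤q+r⇒p-r≤q : ∀ {p q r} → p ℚ.≤ q ℚ.+ r → p ℚ.- r ℚ.≤ q
p≤q+r⇒p-r≤q {p} {q} {r} p≤q+r = subst (p ℚ.- r ℚ.≤_)
  (solve 2 (λ q r → q :+ r :- r := q) refl q r) (ℚ.+-monoˡ-≤ (ℚ.- r) p≤q+r)
  where open +-*-Solver

q+r≤p⇒r≤p-q : ∀ {p q r} → q ℚ.+ r ℚ.≤ p → r ℚ.≤ p ℚ.- q
q+r≤p⇒r≤p-q {p} {q} {r} q+r≤p = subst (ℚ._≤ p ℚ.- q)
  (solve 2 (λ q r → q :+ r :- q := r) refl q r) (ℚ.+-monoˡ-≤ (ℚ.- q) q+r≤p)
  where open +-*-Solver

-- The induction rests on (1 - c)(1 + (n + 1)c) = 1 + nc - (n + 1)c², which is at most 1 + nc. The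
-- product form bounds the power from above without a division.
bernoulli : ∀ c n → 0ℚ ℚ.≤ 1ℚ ℚ.- c →
  (1ℚ ℚ.- c) ^ n ℚ.* (1ℚ ℚ.+ n · c) ℚ.≤ 1ℚ
bernoulli c zero    0≤1-c = from-yes (1ℚ ℚ.* (1ℚ ℚ.+ 0ℚ) ℚ.≤? 1ℚ)
bernoulli c (suc n) 0≤1-c = begin
  (d ℚ.* D) ℚ.* (1ℚ ℚ.+ (c ℚ.+ s))        ≡⟨ solve 3 (λ c D s →
    let d = con 1ℚ :- c in
    (d :* D) :* (con 1ℚ :+ (c :+ s)) := D :* (d :* (con 1ℚ :+ s) :+ d :* c)) refl c D s ⟩
  D ℚ.* (d ℚ.* (1ℚ ℚ.+ s) ℚ.+ d ℚ.* c)    ≤⟨ *-monoˡ-≤ (0≤p^n n 0≤1-c) step ⟩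
  D ℚ.* (1ℚ ℚ.+ s)                        ≤⟨ bernoulli c n 0≤1-c ⟩
  1ℚ                                      ∎
  where
  open ℚ.≤-Reasoning
  open +-*-Solver
  d = 1ℚ ℚ.- c
  D = d ^ n
  s = n · c
  -- The quantity is (n + 1)c², so the sign of `c` does not matter.
  0≤square+s*c : ∀ n → 0ℚ ℚ.≤ c ℚ.* c ℚ.+ n · c ℚ.* c
  0≤square+s*c zero = subst (0ℚ ℚ.≤_)
    (solve 1 (λ c → c :* c := c :* c :+ con 0ℚ :* c) refl c) 0≤square
    where
    0≤square : 0ℚ ℚ.≤ c ℚ.* c
    0≤square with ℚ.≤-total 0ℚ c
    ... | inj₁ 0≤c = 0≤p*q 0≤c 0≤c
    ... | inj₂ c≤0 = subst (0ℚ ℚ.≤_)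
      (solve 1 (λ c → :- c :* :- c := c :* c) refl c)
      (0≤p*q (ℚ.neg-antimono-≤ c≤0) (ℚ.neg-antimono-≤ c≤0))
  0≤square+s*c (suc n) = subst (0ℚ ℚ.≤_)
    (solve 2 (λ c s → c :* c :+ con 0ℚ :* c :+ (c :* c :+ s :* c)
                   := c :* c :+ (c :+ s) :* c) refl c (n · c))
    (ℚ.+-mono-≤ (0≤square+s*c zero) (0≤square+s*c n))
  step : d ℚ.* (1ℚ ℚ.+ s) ℚ.+ d ℚ.* c ℚ.≤ 1ℚ ℚ.+ s
  step = begin
    d ℚ.* (1ℚ ℚ.+ s) ℚ.+ d ℚ.* c
      ≡⟨ solve 2 (λ c s → let d = con 1ℚ :- c in
           d :* (con 1ℚ :+ s) :+ d :* c := (con 1ℚ :+ s) :- (c :* c :+ s :* c)) refl c s ⟩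
    (1ℚ ℚ.+ s) ℚ.- (c ℚ.* c ℚ.+ s ℚ.* c)
      ≤⟨ ℚ.+-monoʳ-≤ (1ℚ ℚ.+ s) (ℚ.neg-antimono-≤ (0≤square+s*c n)) ⟩
    (1ℚ ℚ.+ s) ℚ.+ 0ℚ
      ≡⟨ ℚ.+-identityʳ (1ℚ ℚ.+ s) ⟩
    1ℚ ℚ.+ s ∎

-- Unnormalised fractions turn the iterated sum into one product whose numerator and denominator can
-- be read off.
toℚᵘ-· : ∀ n c → toℚᵘ (n · c) ℚᵘ.≃ mkℚᵘ (+ n) 0 ℚᵘ.* toℚᵘ c
toℚᵘ-· zero    c@record{} = *≡* refl
toℚᵘ-· (suc n) c = begin-equality
  toℚᵘ (c ℚ.+ n · c)                                     ≃⟨ ℚ.toℚᵘ-homo-+ c (n · c) ⟩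
  toℚᵘ c ℚᵘ.+ toℚᵘ (n · c)                               ≃⟨ ℚᵘ.+-congʳ (toℚᵘ c) (toℚᵘ-· n c) ⟩
  toℚᵘ c ℚᵘ.+ mkℚᵘ (+ n) 0 ℚᵘ.* toℚᵘ c
    ≃⟨ ℚᵘ.+-congˡ (mkℚᵘ (+ n) 0 ℚᵘ.* toℚᵘ c) (ℚᵘ.≃-sym (ℚᵘ.*-identityˡ (toℚᵘ c))) ⟩
  ℚᵘ.1ℚᵘ ℚᵘ.* toℚᵘ c ℚᵘ.+ mkℚᵘ (+ n) 0 ℚᵘ.* toℚᵘ c
    ≃⟨ ℚᵘ.≃-sym (ℚᵘ.*-distribʳ-+ (toℚᵘ c) ℚᵘ.1ℚᵘ (mkℚᵘ (+ n) 0)) ⟩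
  (ℚᵘ.1ℚᵘ ℚᵘ.+ mkℚᵘ (+ n) 0) ℚᵘ.* toℚᵘ c
    ≃⟨ ℚᵘ.*-congʳ {toℚᵘ c} suc-≃ ⟩
  mkℚᵘ (+ suc n) 0 ℚᵘ.* toℚᵘ c                           ∎
  where
  open ℚᵘ.≤-Reasoning
  suc-≃ : ℚᵘ.1ℚᵘ ℚᵘ.+ mkℚᵘ (+ n) 0 ℚᵘ.≃ mkℚᵘ (+ suc n) 0
  suc-≃ = *≡* (cong (λ i → (+ 1 ℤ.+ i) ℤ.* + 1) (ℤ.*-identityʳ (+ n)))

-- The denominator of `c` serves as the multiplier: the product is then the numerator, a positive
-- integer.
archimedean : ∀ c → 0ℚ ℚ.< c → ∃[ n ] 1ℚ ℚ.≤ n · c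
archimedean c@(mkℚ +[1+ n ] d-1 _) _ = suc d-1 , ℚ.toℚᵘ-cancel-≤ (begin
  ℚᵘ.1ℚᵘ                                   ≤⟨ *≤* 1≤ ⟩
  mkℚᵘ (+ suc d-1) 0 ℚᵘ.* toℚᵘ c           ≃⟨ ℚᵘ.≃-sym (toℚᵘ-· (suc d-1) c) ⟩
  toℚᵘ (suc d-1 · c)                       ∎)
  where
  open ℚᵘ.≤-Reasoning
  1≤ : + 1 ℤ.* (+ 1 ℤ.* + suc d-1) ℤ.≤ (+ suc d-1 ℤ.* + suc n) ℤ.* + 1
  1≤ = subst₂ ℤ._≤_
    (sym (trans (ℤ.*-identityˡ _) (ℤ.*-identityˡ _)))
    (sym (trans (ℤ.*-identityʳ _) (sym (ℤ.pos-* (suc d-1) (suc n)))))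
    (ℤ.+≤+ (ℕ.m≤m*n (suc d-1) (suc n)))
archimedean (mkℚ (+ 0) _ _) (ℚ.*<* (ℤ.+<+ ()))
archimedean (mkℚ (ℤ.-[1+ _ ]) _ _) (ℚ.*<* ())

-- Once nc ≥ 1, `bernoulli` gives 2(1 - c)^n ≤ 1.
power≤½ : ∀ c → 0ℚ ℚ.< c → 0ℚ ℚ.≤ 1ℚ ℚ.- c → ∃[ n ] (1ℚ ℚ.- c) ^ n ℚ.≤ ½
power≤½ c 0<c 0≤1-c =
  let n , 1≤n·c = archimedean c 0<c
      x = (1ℚ ℚ.- c) ^ n
  in n , (begin
    x
      ≡⟨ solve 1 (λ x → x := con ½ :* (x :* (con 1ℚ :+ con 1ℚ))) refl x ⟩
    ½ ℚ.* (x ℚ.* (1ℚ ℚ.+ 1ℚ))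
      ≤⟨ ℚ.*-monoˡ-≤-nonNeg ½ (*-monoˡ-≤ (0≤p^n n 0≤1-c) (ℚ.+-monoʳ-≤ 1ℚ 1≤n·c)) ⟩
    ½ ℚ.* (x ℚ.* (1ℚ ℚ.+ n · c))      ≤⟨ ℚ.*-monoˡ-≤-nonNeg ½ (bernoulli c n 0≤1-c) ⟩
    ½ ℚ.* 1ℚ                          ≡⟨ ℚ.*-identityʳ ½ ⟩
    ½                                 ∎)
  where
  open ℚ.≤-Reasoning
  open +-*-Solver

-- Eventual properties of Cauchy sequences

Eventually : (ℕ → Set) → Set
Eventually P = ∃[ N ] ∀ k → N ≤ k → P k

eventually-map : ∀ {P Q : ℕ → Set} → (∀ k → P k → Q k) → Eventually P → Eventually Q
eventually-map f (N , h) = N , λ k N≤k → f k (h k N≤k)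

eventually-zip : ∀ {P Q R : ℕ → Set} → (∀ k → P k → Q k → R k) →
  Eventually P → Eventually Q → Eventually R
eventually-zip f (M , g) (N , h) = M ⊔ N , λ k M⊔N≤k →
  f k (g k (ℕ.m⊔n≤o⇒m≤o M N M⊔N≤k)) (h k (ℕ.m⊔n≤o⇒n≤o M N M⊔N≤k))

-- A real cannot be compared with `q` exactly, but one late rational term can, and all later terms
-- stay within `ε` of it.
eventually-near : ∀ x q ε → 0ℚ ℚ.< ε →
  Eventually (λ k → q ℚ.- ε ℚ.≤ seq x k) ⊎ Eventually (λ k → seq x k ℚ.≤ q ℚ.+ ε)
eventually-near x q ε 0<ε with cauchy x ε 0<ε
... | N , h with ℚ.≤-total q (seq x N)
...   | inj₁ q≤xN = inj₁ (N , λ k N≤k → p≤q+r⇒p-r≤q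
          (ℚ.≤-trans q≤xN (∣p-q∣<r⇒p≤q+r (h N k ℕ.≤-refl N≤k))))
...   | inj₂ xN≤q = inj₂ (N , λ k N≤k →
          ℚ.≤-trans (∣p-q∣<r⇒p≤q+r (h k N N≤k ℕ.≤-refl)) (ℚ.+-monoˡ-≤ ε xN≤q))

-- Expectations over independent coin tosses

IsProbability : ℚ → Set
IsProbability q = 0ℚ ℚ.≤ q × 0ℚ ℚ.≤ 1ℚ ℚ.- q

isProbability-complement : ∀ {q} → IsProbability q → IsProbability (1ℚ ℚ.- q)
isProbability-complement {q} (0≤q , 0≤1-q) = 0≤1-q , subst (0ℚ ℚ.≤_) (sym (1-1-p q)) 0≤q

-- Expectation for a coin of rational bias, by recursion on the first toss. Inductions thus avoid
-- the list `outcomes`, and real probabilities are handled one approximation at a time.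
E : ∀ {N} → ℚ → (Vec Bool N → ℚ) → ℚ
E {zero}  q F = F []
E {suc N} q F = q ℚ.* E q (F ∘ (true ∷_)) ℚ.+ (1ℚ ℚ.- q) ℚ.* E q (F ∘ (false ∷_))

E-mono : ∀ {N q} → IsProbability q → {F G : Vec Bool N → ℚ} →
  (∀ ω → F ω ℚ.≤ G ω) → E q F ℚ.≤ E q G
E-mono {zero}  _                F≤G = F≤G []
E-mono {suc N} pr@(0≤q , 0≤1-q) F≤G = ℚ.+-mono-≤
  (*-monoˡ-≤ 0≤q   (E-mono pr (F≤G ∘ (true ∷_))))
  (*-monoˡ-≤ 0≤1-q (E-mono pr (F≤G ∘ (false ∷_))))

E-const : ∀ N q c → E {N} q (λ _ → c) ≡ c
E-const zero    q c = refl
E-const (suc N) q c = trans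
  (cong₂ (λ a b → q ℚ.* a ℚ.+ (1ℚ ℚ.- q) ℚ.* b) (E-const N q c) (E-const N q c))
  (solve 2 (λ q c → q :* c :+ (con 1ℚ :- q) :* c := c) refl q c)
  where open +-*-Solver

E-+ : ∀ {N} q (F G : Vec Bool N → ℚ) → E q (λ ω → F ω ℚ.+ G ω) ≡ E q F ℚ.+ E q G
E-+ {zero}  q F G = refl
E-+ {suc N} q F G = trans
  (cong₂ (λ a b → q ℚ.* a ℚ.+ (1ℚ ℚ.- q) ℚ.* b) 
    (E-+ q (F ∘ (true ∷_)) (G ∘ (true ∷_))) (E-+ q (F ∘ (false ∷_)) (G ∘ (false ∷_))))
  (solve 5 (λ q a b c d →
     q :* (a :+ b) :+ (con 1ℚ :- q) :* (c :+ d)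
     := (q :* a :+ (con 1ℚ :- q) :* c) :+ (q :* b :+ (con 1ℚ :- q) :* d)) refl
     q (E q (F ∘ (true ∷_))) (E q (G ∘ (true ∷_))) (E q (F ∘ (false ∷_))) (E q (G ∘ (false ∷_))))
  where open +-*-Solver

E-scale : ∀ {N} q c (F : Vec Bool N → ℚ) → E q (λ ω → c ℚ.* F ω) ≡ c ℚ.* E q F
E-scale {zero}  q c F = refl
E-scale {suc N} q c F = trans
  (cong₂ (λ a b → q ℚ.* a ℚ.+ (1ℚ ℚ.- q) ℚ.* b) 
    (E-scale q c (F ∘ (true ∷_))) (E-scale q c (F ∘ (false ∷_))))
  (solve 4 (λ q c a b →
     q :* (c :* a) :+ (con 1ℚ :- q) :* (c :* b) := c :* (q :* a :+ (con 1ℚ :- q) :* b)) refl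
     q c (E q (F ∘ (true ∷_))) (E q (F ∘ (false ∷_))))
  where open +-*-Solver

E-complement : ∀ {N} q (F : Vec Bool N → ℚ) → E q (λ ω → 1ℚ ℚ.- F ω) ≡ 1ℚ ℚ.- E q F
E-complement {zero}  q F = refl
E-complement {suc N} q F = trans
  (cong₂ (λ a b → q ℚ.* a ℚ.+ (1ℚ ℚ.- q) ℚ.* b) 
    (E-complement q (F ∘ (true ∷_))) (E-complement q (F ∘ (false ∷_))))
  (solve 3 (λ q a b →
     q :* (con 1ℚ :- a) :+ (con 1ℚ :- q) :* (con 1ℚ :- b)
     := con 1ℚ :- (q :* a :+ (con 1ℚ :- q) :* b)) refl
     q (E q (F ∘ (true ∷_))) (E q (F ∘ (false ∷_))))
  where open +-*-Solver

-- Independence of the first `M` and the last `N` tosses. An inequality suffices because a failure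
-- of the combined game is only bounded by the product of the two failures.
E-product : ∀ {M N q} → IsProbability q →
  (F : Vec Bool (M + N) → ℚ) (G : Vec Bool M → ℚ) (H : Vec Bool N → ℚ) →
  (∀ ω ω′ → F (ω Vec.++ ω′) ℚ.≤ G ω ℚ.* H ω′) → E q F ℚ.≤ E q G ℚ.* E q H
E-product {zero} {q = q} pr F G H F≤GH = subst (E q F ℚ.≤_) (E-scale q (G []) H)
  (E-mono pr (F≤GH []))
E-product {suc M} {q = q} pr@(0≤q , 0≤1-q) F G H F≤GH = begin
  E q F
    ≤⟨ ℚ.+-mono-≤
         (*-monoˡ-≤ 0≤q   (E-product {M} pr _ (G ∘ (true ∷_))  H (F≤GH ∘ (true ∷_))))
         (*-monoˡ-≤ 0≤1-q (E-product {M} pr _ (G ∘ (false ∷_)) H (F≤GH ∘ (false ∷_)))) ⟩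
  q ℚ.* (a ℚ.* h) ℚ.+ (1ℚ ℚ.- q) ℚ.* (b ℚ.* h)
    ≡⟨ solve 4 (λ q a b h → q :* (a :* h) :+ (con 1ℚ :- q) :* (b :* h)
                          := (q :* a :+ (con 1ℚ :- q) :* b) :* h) refl q a b h ⟩
  E q G ℚ.* h ∎
  where
  open ℚ.≤-Reasoning
  open +-*-Solver
  a = E q (G ∘ (true ∷_))
  b = E q (G ∘ (false ∷_))
  h = E q H

E-flip : ∀ {N} q (F : Vec Bool N → ℚ) → E (1ℚ ℚ.- q) F ≡ E q (F ∘ Vec.map not)
E-flip {zero}  q F = refl
E-flip {suc N} q F = trans
  (cong₂ (λ a b → (1ℚ ℚ.- q) ℚ.* a ℚ.+ (1ℚ ℚ.- (1ℚ ℚ.- q)) ℚ.* b)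
    (E-flip q (F ∘ (true ∷_))) (E-flip q (F ∘ (false ∷_))))
  (solve 3 (λ q a b →
     (con 1ℚ :- q) :* a :+ (con 1ℚ :- (con 1ℚ :- q)) :* b
     := q :* b :+ (con 1ℚ :- q) :* a) refl
     q (E q (F ∘ (true ∷_) ∘ Vec.map not)) (E q (F ∘ (false ∷_) ∘ Vec.map not)))
  where open +-*-Solver

-- Only the all-true branch is kept. The bound uses `c` instead of `q` so that it stays fixed while
-- `q` runs through the approximations of a real.
E-all-true : ∀ {N c q} → 0ℚ ℚ.≤ c → c ℚ.≤ q → IsProbability q →
  (F : Vec Bool N → ℚ) → (∀ ω → 0ℚ ℚ.≤ F ω) → F (Vec.replicate N true) ≡ 1ℚ →
  c ^ N ℚ.≤ E q F
E-all-true {zero}          0≤c c≤q pr F 0≤F F≡1 = ℚ.≤-reflexive (sym F≡1)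
E-all-true {suc N} {c} {q} 0≤c c≤q pr@(0≤q , 0≤1-q) F 0≤F F≡1 = begin
  c ℚ.* c ^ N
    ≤⟨ *-monoʳ-≤ (0≤p^n N 0≤c) c≤q ⟩
  q ℚ.* c ^ N
    ≤⟨ *-monoˡ-≤ 0≤q (E-all-true 0≤c c≤q pr (F ∘ (true ∷_)) (0≤F ∘ (true ∷_)) F≡1) ⟩
  q ℚ.* E q (F ∘ (true ∷_))
    ≡⟨ sym (ℚ.+-identityʳ _) ⟩
  q ℚ.* E q (F ∘ (true ∷_)) ℚ.+ 0ℚ
    ≤⟨ ℚ.+-monoʳ-≤ (q ℚ.* E q (F ∘ (true ∷_))) (0≤p*q 0≤1-q
         (subst (ℚ._≤ E q (F ∘ (false ∷_))) (E-const N q 0ℚ) (E-mono pr (0≤F ∘ (false ∷_))))) ⟩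
  E q F ∎
  where open ℚ.≤-Reasoning

-- Real sums over outcomes as rational expectations

sum-++ : ∀ {A : Set} k (f : A → ℝ) xs ys →
  seq (sumℝ (List.map f (xs ++ ys))) k
  ≡ seq (sumℝ (List.map f xs)) k ℚ.+ seq (sumℝ (List.map f ys)) k
sum-++ k f []       ys = sym (ℚ.+-identityˡ _)
sum-++ k f (x ∷ xs) ys = trans (cong (seq (f x) k ℚ.+_) (sum-++ k f xs ys))
  (sym (ℚ.+-assoc (seq (f x) k) _ _))

sum-map-scale : ∀ {A B : Set} k c (f : B → ℝ) (g : A → ℝ) (h : A → B) →
  (∀ x → seq (f (h x)) k ≡ c ℚ.* seq (g x) k) → ∀ xs →
  seq (sumℝ (List.map f (List.map h xs))) k ≡ c ℚ.* seq (sumℝ (List.map g xs)) k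
sum-map-scale k c f g h eq []       = sym (ℚ.*-zeroʳ c)
sum-map-scale k c f g h eq (x ∷ xs) = trans
  (cong₂ ℚ._+_ (eq x) (sum-map-scale k c f g h eq xs))
  (sym (ℚ.*-distribˡ-+ c (seq (g x) k) _))

-- The summand `g` is known only through its `k`-th terms, so its Cauchy proof never has to be
-- compared.
weighted-sum≡E : ∀ {N} p k (f : Vec Bool N → ℚ) (g : Vec Bool N → ℝ) →
  (∀ ω → seq (g ω) k ≡ seq (weight p ω) k ℚ.* f ω) →
  seq (sumℝ (List.map g (outcomes N))) k ≡ E (seq p k) f
weighted-sum≡E {zero}  p k f g g≡ =
  trans (ℚ.+-identityʳ (seq (g []) k)) (trans (g≡ []) (ℚ.*-identityˡ (f [])))
weighted-sum≡E {suc N} p k f g g≡ = trans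
  (sum-++ k g (List.map (true ∷_) (outcomes N)) (List.map (false ∷_) (outcomes N)))
  (cong₂ ℚ._+_ (branch true (seq p k) (λ _ → refl))
               (branch false (1ℚ ℚ.- seq p k) (λ _ → refl)))
  where
  branch : ∀ b c → (∀ ω → seq (weight p (b ∷ ω)) k ≡ c ℚ.* seq (weight p ω) k) →
    seq (sumℝ (List.map g (List.map (b ∷_) (outcomes N)))) k
    ≡ c ℚ.* E (seq p k) (λ ω → f (b ∷ ω))
  branch b c weight≡ = trans
    (sum-map-scale k c g h (b ∷_)
      (λ ω → trans (g≡ (b ∷ ω)) (trans (cong (ℚ._* f (b ∷ ω)) (weight≡ ω))
                   (ℚ.*-assoc c (seq (weight p ω) k) (f (b ∷ ω)))))
      (outcomes N))
    (cong (c ℚ.*_) (weighted-sum≡E p k (λ ω → f (b ∷ ω)) h (λ _ → refl)))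
    where
    h : Vec Bool N → ℝ
    h ω = weight p ω *ℝ fromℚ (f (b ∷ ω))

-- These expectations are the terms of a real number built by the arithmetic of reals, which
-- supplies their Cauchy property.
E-near : ∀ {N} p (f : Vec Bool N → ℚ) q ε → 0ℚ ℚ.< ε →
  Eventually (λ k → q ℚ.- ε ℚ.≤ E (seq p k) f) ⊎ Eventually (λ k → E (seq p k) f ℚ.≤ q ℚ.+ ε)
E-near {N} p f q ε 0<ε = [ inj₁ ∘ eventually-map (λ k → subst (q ℚ.- ε ℚ.≤_) (x≡E k))
                         , inj₂ ∘ eventually-map (λ k → subst (ℚ._≤ q ℚ.+ ε) (x≡E k))
                         ]′ (eventually-near x q ε 0<ε)
  where
  x : ℝ
  x = sumℝ (List.map (λ ω → weight p ω *ℝ fromℚ (f ω)) (outcomes N))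
  x≡E : ∀ k → seq x k ≡ E (seq p k) f
  x≡E k = weighted-sum≡E p k f (λ ω → weight p ω *ℝ fromℚ (f ω)) (λ _ → refl)

-- Embeddings of the vertex set

StrictlyMonotone : (ℤ → ℤ) → Set
StrictlyMonotone g = ∀ {u v} → u ℤ.< v → g u ℤ.< g v

strictlyMonotone⇒injective : ∀ {g} → StrictlyMonotone g → ∀ {u v} → g u ≡ g v → u ≡ v
strictlyMonotone⇒injective mono {u} {v} gu≡gv with ℤ.<-cmp u v
... | tri< u<v _ _ = ⊥-elim (ℤ.<-irrefl gu≡gv (mono u<v))
... | tri≈ _ u≡v _ = u≡v
... | tri> _ _ v<u = ⊥-elim (ℤ.<-irrefl (sym gu≡gv) (mono v<u))

mapPair : (g : ℤ → ℤ) → StrictlyMonotone g → Pair → Pair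
mapPair g mono (pair lo hi lo<hi) = pair (g lo) (g hi) (mono lo<hi)

mapPair-injective : ∀ {g} (mono : StrictlyMonotone g) {e e′} →
  mapPair g mono e ≡ mapPair g mono e′ → e ≡ e′
mapPair-injective mono eq = pair-≡
  (strictlyMonotone⇒injective mono (cong Pair.lo eq))
  (strictlyMonotone⇒injective mono (cong Pair.hi eq))
  where
  -- The order proof is irrelevant, so the endpoints determine the pair.
  pair-≡ : ∀ {e e′} → Pair.lo e ≡ Pair.lo e′ → Pair.hi e ≡ Pair.hi e′ → e ≡ e′
  pair-≡ refl refl = refl

-- Two order-preserving embeddings with disjoint images, which make room for two games on one board.
even odd : ℤ → ℤ
even v = v ℤ.+ v
odd  v = ℤ.suc (even v)

even-mono : StrictlyMonotone even
even-mono u<v = ℤ.+-mono-< u<v u<v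

odd-mono : StrictlyMonotone odd
odd-mono u<v = ℤ.+-monoʳ-< (+ 1) (even-mono u<v)

even≢odd : ∀ u v → even u ≢ odd v
even≢odd u v eq with ℤ.<-cmp v u
-- Here 1 + 2v < 2(v + 1) ≤ 2u.
... | tri< v<u _ _ = ℤ.<-irrefl (sym eq) (ℤ.<-≤-trans
        (subst (ℤ._< ℤ.suc v ℤ.+ ℤ.suc v) (ℤ.+-assoc (+ 1) v v)
          (ℤ.+-monoʳ-< (ℤ.suc v) (ℤ.suc[i]≤j⇒i<j ℤ.≤-refl)))
        (ℤ.+-mono-≤ (ℤ.i<j⇒suc[i]≤j v<u) (ℤ.i<j⇒suc[i]≤j v<u)))
... | tri≈ _ refl _ = ℤ.<-irrefl eq (ℤ.suc[i]≤j⇒i<j ℤ.≤-refl)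
... | tri> _ _ u<v = ℤ.<-irrefl eq (ℤ.<-trans (even-mono u<v) (ℤ.suc[i]≤j⇒i<j ℤ.≤-refl))

evenPair oddPair : Pair → Pair
evenPair = mapPair even even-mono
oddPair  = mapPair odd odd-mono

evenPair≢oddPair : ∀ e e′ → evenPair e ≢ oddPair e′
evenPair≢oddPair e e′ = even≢odd (Pair.lo e) (Pair.lo e′) ∘ cong Pair.lo

-- Boards and copies of graphs

Board : Set
Board = List (Pair × Bool)

∈-withOutcome⁺ : ∀ {e b} {board : Board} → (e , b) ∈ board → e ∈ withOutcome b board
∈-withOutcome⁺ {b = b} eb∈ = ∈-map∘filter⁺ proj₁ (λ x → b ≟ᵇ proj₂ x) (_ , eb∈ , refl , refl)

∈-withOutcome⁻ : ∀ {e b} {board : Board} → e ∈ withOutcome b board → (e , b) ∈ board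
∈-withOutcome⁻ {b = b} e∈ with ∈-map∘filter⁻ proj₁ (λ x → b ≟ᵇ proj₂ x) e∈
... | _ , eb∈ , refl , refl = eb∈

-- The outcome may change from `b` to `c`, so that one lemma covers both moving a copy along an
-- embedding and exchanging the colours.
containsCopy-map : ∀ H {b c} {board board′ : Board} {g} (mono : StrictlyMonotone g) →
  (∀ {e} → (e , b) ∈ board → (mapPair g mono e , c) ∈ board′) →
  ContainsCopy H (withOutcome b board) → ContainsCopy H (withOutcome c board′)
containsCopy-map H {board = board} {board′} {g} mono sub (φ , φ-injective , φ-edges) =
  g ∘ φ , φ-injective ∘ strictlyMonotone⇒injective mono , λ i j i~j →
    let e , e∈ , joins = find (φ-edges i j i~j)
    in lose (∈-withOutcome⁺ {board = board′} (sub (∈-withOutcome⁻ {board = board} e∈)))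
            (joins-map {φ i} {φ j} {e} joins)
  where
  joins-map : ∀ {u v e} → Joins u v e → Joins (g u) (g v) (mapPair g mono e)
  joins-map (inj₁ (refl , refl)) = inj₁ (refl , refl)
  joins-map (inj₂ (refl , refl)) = inj₂ (refl , refl)

containsCopy-⊆ : ∀ H {b c} {board board′ : Board} →
  (∀ {e} → (e , b) ∈ board → (e , c) ∈ board′) →
  ContainsCopy H (withOutcome b board) → ContainsCopy H (withOutcome c board′)
containsCopy-⊆ H = containsCopy-map H {g = id} id

EmbeddingClosed : (Board → Set) → Set
EmbeddingClosed W = ∀ {g} (mono : StrictlyMonotone g) {b b′} →
  (∀ {e c} → (e , c) ∈ b → (mapPair g mono e , c) ∈ b′) → W b → W b′

Recolours : Board → Board → Set
Recolours b b′ = ∀ {e c} → (e , c) ∈ b → (e , not c) ∈ b′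

-- Constructions of strategies

-- The strategy is told the opposite of each outcome; on complementary tosses it therefore chooses
-- the same pairs as before.
flip : ∀ {used N} → Strategy used N → Strategy used N
flip done              = done
flip (turn e e∉ cont)  = turn e e∉ (λ b → flip (cont (not b)))

play-flip : ∀ {used N} (σ : Strategy used N) ω →
  Recolours (play σ ω) (play (flip σ) (Vec.map not ω))
play-flip done                 []          ()
play-flip (turn e e∉ cont) (b ∷ ω)     (here refl) = here refl
play-flip (turn e e∉ cont) (true ∷ ω)  (there ec∈) = there (play-flip (cont true) ω ec∈)
play-flip (turn e e∉ cont) (false ∷ ω) (there ec∈) = there (play-flip (cont false) ω ec∈)

map-not-involutive : ∀ {N} (ω : Vec Bool N) → Vec.map not (Vec.map not ω) ≡ ω
map-not-involutive ω = trans (sym (Vec.map-∘ not not ω))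
  (trans (Vec.map-cong not-involutive ω) (Vec.map-id ω))

-- All of the first strategy runs on even vertices, then the second on odd ones, ignoring the
-- earlier outcomes; this gives independence. The two hypotheses keep pairs fresh: a used even or
-- odd pair can only come from its own strategy.
interleave : ∀ {used used₁ used₂ M N} →
  (∀ {e} → evenPair e ∈ used → e ∈ used₁) → (∀ {e} → oddPair e ∈ used → e ∈ used₂) →
  Strategy used₁ M → Strategy used₂ N → Strategy used (M + N)
interleave even⁻ odd⁻ done done = done
interleave even⁻ odd⁻ done (turn e e∉ cont) =
  turn (oddPair e) (e∉ ∘ odd⁻) λ b → interleave
    (λ { {e′} (here eq) → ⊥-elim (evenPair≢oddPair e′ e eq) ; (there x) → even⁻ x })
    (λ { (here eq) → here (mapPair-injective odd-mono eq) ; (there x) → there (odd⁻ x) })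
    done (cont b)
interleave even⁻ odd⁻ (turn e e∉ cont) τ =
  turn (evenPair e) (e∉ ∘ even⁻) λ b → interleave
    (λ { (here eq) → here (mapPair-injective even-mono eq) ; (there x) → there (even⁻ x) })
    (λ { {e′} (here eq) → ⊥-elim (evenPair≢oddPair e e′ (sym eq)) ; (there x) → odd⁻ x })
    (cont b) τ

play-interleaveˡ : ∀ {used used₁ used₂ M N}
  (even⁻ : ∀ {e} → evenPair e ∈ used → e ∈ used₁) (odd⁻ : ∀ {e} → oddPair e ∈ used → e ∈ used₂)
  (σ : Strategy used₁ M) (τ : Strategy used₂ N) ω ω′ {e c} →
  (e , c) ∈ play σ ω → (evenPair e , c) ∈ play (interleave even⁻ odd⁻ σ τ) (ω Vec.++ ω′)
play-interleaveˡ even⁻ odd⁻ done τ [] ω′ ()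
play-interleaveˡ even⁻ odd⁻ (turn e e∉ cont) τ (b ∷ ω) ω′ (here refl) = here refl
play-interleaveˡ even⁻ odd⁻ (turn e e∉ cont) τ (b ∷ ω) ω′ (there ec∈) =
  there (play-interleaveˡ _ _ (cont b) τ ω ω′ ec∈)

play-interleaveʳ : ∀ {used used₁ used₂ M N}
  (even⁻ : ∀ {e} → evenPair e ∈ used → e ∈ used₁) (odd⁻ : ∀ {e} → oddPair e ∈ used → e ∈ used₂)
  (σ : Strategy used₁ M) (τ : Strategy used₂ N) ω ω′ {e c} →
  (e , c) ∈ play τ ω′ → (oddPair e , c) ∈ play (interleave even⁻ odd⁻ σ τ) (ω Vec.++ ω′)
play-interleaveʳ even⁻ odd⁻ done done [] [] ()
play-interleaveʳ even⁻ odd⁻ done (turn e e∉ cont) [] (b ∷ ω′) (here refl) = here refl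
play-interleaveʳ even⁻ odd⁻ done (turn e e∉ cont) [] (b ∷ ω′) (there ec∈) =
  there (play-interleaveʳ _ _ done (cont b) [] ω′ ec∈)
play-interleaveʳ even⁻ odd⁻ (turn e e∉ cont) τ (b ∷ ω) ω′ ec∈ =
  there (play-interleaveʳ _ _ (cont b) τ ω ω′ ec∈)

repeat : ∀ {N} → Strategy [] N → ∀ j → Strategy [] (j * N)
repeat σ zero    = done
repeat σ (suc j) = interleave (λ ()) (λ ()) σ (repeat σ j)

-- Junk value when u ≡ v.
link : ℤ → ℤ → Pair
link u v with ℤ.<-cmp u v
... | tri< u<v _ _ = pair u v u<v
... | tri≈ _ _ _   = pair u (ℤ.suc u) (ℤ.suc[i]≤j⇒i<j ℤ.≤-refl)
... | tri> _ _ v<u = pair v u v<u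

link-joins : ∀ {u v} → u ≢ v → Joins u v (link u v)
link-joins {u} {v} u≢v with ℤ.<-cmp u v
... | tri< _ _ _   = inj₁ (refl , refl)
... | tri≈ _ u≡v _ = ⊥-elim (u≢v u≡v)
... | tri> _ _ _   = inj₂ (refl , refl)

-- Minima and probabilities of events

isMinimum-cong : ∀ {P Q : ℕ → Set} {n} → (∀ {k} → P k → Q k) → (∀ {k} → Q k → P k) →
  IsMinimum P n → IsMinimum Q n
isMinimum-cong P⇒Q Q⇒P min = record
  { attained = P⇒Q (IsMinimum.attained min) ; least = λ q → IsMinimum.least min (Q⇒P q) }

module Classical (em : ExcludedMiddle 0ℓ) where

  minimum-exists : ∀ {P : ℕ → Set} n → P n → ∃[ m ] IsMinimum P m
  minimum-exists {P} = <-rec _ λ n rec Pn → case n Pn rec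
    where
    case : ∀ n → P n → (∀ {k} → k ℕ.< n → P k → ∃[ m ] IsMinimum P m) →
      ∃[ m ] IsMinimum P m
    case n Pn rec with em {∃[ k ] (k ℕ.< n × P k)}
    ... | yes (k , k<n , Pk) = rec k<n Pk
    ... | no none = n , record
      { attained = Pn ; least = λ {k} Pk → ℕ.≮⇒≥ (λ k<n → none (k , k<n , Pk)) }

  χ : Set → ℚ
  χ A = if does (em {A}) then 1ℚ else 0ℚ

  𝟙≡χ : ∀ A k → seq (Games.𝟙 em A) k ≡ χ A
  𝟙≡χ A k with em {A}
  ... | yes _ = refl
  ... | no  _ = refl

  χ-cases : ∀ A → (A × χ A ≡ 1ℚ) ⊎ (¬ A × χ A ≡ 0ℚ)
  χ-cases A with em {A}
  ... | yes a = inj₁ (a , refl)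
  ... | no ¬a = inj₂ (¬a , refl)

  χ-true : ∀ {A} → A → χ A ≡ 1ℚ
  χ-true {A} a with χ-cases A
  ... | inj₁ (_ , eq) = eq
  ... | inj₂ (¬a , _) = ⊥-elim (¬a a)

  0≤χ : ∀ A → 0ℚ ℚ.≤ χ A
  0≤χ A with χ-cases A
  ... | inj₁ (_ , eq) = subst (0ℚ ℚ.≤_) (sym eq) (from-yes (0ℚ ℚ.≤? 1ℚ))
  ... | inj₂ (_ , eq) = ℚ.≤-reflexive (sym eq)

  χ≤1 : ∀ A → χ A ℚ.≤ 1ℚ
  χ≤1 A with χ-cases A
  ... | inj₁ (_ , eq) = ℚ.≤-reflexive eq
  ... | inj₂ (_ , eq) = subst (ℚ._≤ 1ℚ) (sym eq) (from-yes (0ℚ ℚ.≤? 1ℚ))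

  χ-mono : ∀ {A B} → (A → B) → χ A ℚ.≤ χ B
  χ-mono {A} {B} A→B with χ-cases A
  ... | inj₁ (a , eq) = ℚ.≤-reflexive (trans eq (sym (χ-true (A→B a))))
  ... | inj₂ (_ , eq) = subst (ℚ._≤ χ B) (sym eq) (0≤χ B)

  χ-⊎ : ∀ A B → χ (A ⊎ B) ℚ.≤ χ A ℚ.+ χ B
  χ-⊎ A B with χ-cases (A ⊎ B)
  ... | inj₂ (_ , eq) = subst (ℚ._≤ χ A ℚ.+ χ B) (sym eq) (ℚ.+-mono-≤ (0≤χ A) (0≤χ B))
  ... | inj₁ (inj₁ a , eq) = subst₂ ℚ._≤_ (sym eq)
    (cong (ℚ._+ χ B) (sym (χ-true a))) (ℚ.+-monoʳ-≤ 1ℚ (0≤χ B))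
  ... | inj₁ (inj₂ b , eq) = subst₂ ℚ._≤_ (sym eq)
    (cong (χ A ℚ.+_) (sym (χ-true b))) (ℚ.+-monoˡ-≤ 1ℚ (0≤χ A))

  -- When `C` fails, both `A` and `B` fail, and the right side is 1.
  χ-failure : ∀ {A B C} → (A → C) → (B → C) →
    1ℚ ℚ.- χ C ℚ.≤ (1ℚ ℚ.- χ A) ℚ.* (1ℚ ℚ.- χ B)
  χ-failure {A} {B} {C} A→C B→C with χ-cases C
  ... | inj₁ (_ , eq) = subst (ℚ._≤ (1ℚ ℚ.- χ A) ℚ.* (1ℚ ℚ.- χ B))
    (sym (cong (λ x → 1ℚ ℚ.- x) eq))
    (0≤p*q (complement-antimono (χ≤1 A)) (complement-antimono (χ≤1 B)))
  ... | inj₂ (¬c , eq) with χ-cases A | χ-cases B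
  ...   | inj₁ (a , _) | _ = ⊥-elim (¬c (A→C a))
  ...   | inj₂ _ | inj₁ (b , _) = ⊥-elim (¬c (B→C b))
  ...   | inj₂ (_ , eqA) | inj₂ (_ , eqB) = ℚ.≤-reflexive (trans (cong (λ x → 1ℚ ℚ.- x) eq)
    (sym (cong₂ (λ a b → (1ℚ ℚ.- a) ℚ.* (1ℚ ℚ.- b)) eqA eqB)))

  ℙ : ∀ {N} → ℝ → (Vec Bool N → Set) → ℕ → ℚ
  ℙ p A k = E (seq p k) (λ ω → χ (A ω))

  -- Equivalent to Achievable, but free of the Cauchy proofs contained in Pr: these
  -- make the comparison of goals that agree only up to unfolding intractable.
  Reaches : ℝ → (Board → Set) → ℕ → Set
  Reaches p W N = Σ[ σ ∈ Strategy [] N ]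
    (∀ ε → 0ℚ ℚ.< ε → Eventually (λ k → ½ ℚ.≤ ℙ p (λ ω → W (play σ ω)) k ℚ.+ ε))

  ℙ≡weighted-sum : ∀ {N} p (A : Vec Bool N → Set) (g : Vec Bool N → ℝ) k →
    (∀ ω → seq (g ω) k ≡ seq (weight p ω) k ℚ.* seq (Games.𝟙 em (A ω)) k) →
    ℙ p A k ≡ seq (sumℝ (List.map g (outcomes N))) k
  ℙ≡weighted-sum p A g k g≡ = sym (weighted-sum≡E p k (λ ω → χ (A ω)) g
    (λ ω → trans (g≡ ω) (cong (seq (weight p ω) k ℚ.*_) (𝟙≡χ (A ω) k))))

  module _ {N : ℕ} {p : ℝ} {A : Vec Bool N → Set} {g : Vec Bool N → ℝ}
           (g≡ : ∀ k ω → seq (g ω) k ≡ seq (weight p ω) k ℚ.* seq (Games.𝟙 em (A ω)) k) where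

    ½≤sum⇒½≤ℙ : (∀ ε → 0ℚ ℚ.< ε →
        Eventually (λ k → ½ ℚ.≤ seq (sumℝ (List.map g (outcomes N))) k ℚ.+ ε)) →
      ∀ ε → 0ℚ ℚ.< ε → Eventually (λ k → ½ ℚ.≤ ℙ p A k ℚ.+ ε)
    ½≤sum⇒½≤ℙ ½≤ ε 0<ε = eventually-map
      (λ k → subst (λ x → ½ ℚ.≤ x ℚ.+ ε) (sym (ℙ≡weighted-sum p A g k (g≡ k)))) (½≤ ε 0<ε)

    ½≤ℙ⇒½≤sum : (∀ ε → 0ℚ ℚ.< ε → Eventually (λ k → ½ ℚ.≤ ℙ p A k ℚ.+ ε)) →
      ∀ ε → 0ℚ ℚ.< ε →
        Eventually (λ k → ½ ℚ.≤ seq (sumℝ (List.map g (outcomes N))) k ℚ.+ ε)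
    ½≤ℙ⇒½≤sum ½≤ ε 0<ε = eventually-map
      (λ k → subst (λ x → ½ ℚ.≤ x ℚ.+ ε) (ℙ≡weighted-sum p A g k (g≡ k))) (½≤ ε 0<ε)

  reaches-transfer : ∀ {N} p q (V W : Board → Set) (σ τ : Strategy [] N) →
    Eventually (λ k → ℙ p (λ ω → V (play σ ω)) k ℚ.≤ ℙ q (λ ω → W (play τ ω)) k) →
    (∀ ε → 0ℚ ℚ.< ε → Eventually (λ k → ½ ℚ.≤ ℙ p (λ ω → V (play σ ω)) k ℚ.+ ε)) →
    Reaches q W N
  reaches-transfer p q V W σ τ σ≤τ ½≤ = τ , λ ε 0<ε →
    eventually-zip (λ k V≤W ½≤V → ℚ.≤-trans ½≤V (ℚ.+-monoˡ-≤ ε V≤W)) σ≤τ (½≤ ε 0<ε)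

  module _ {N} (p : ℝ) (A B : Vec Bool N → Set) (k : ℕ) (pr : IsProbability (seq p k)) where

    ℙ-mono : (∀ ω → A ω → B ω) → ℙ p A k ℚ.≤ ℙ p B k
    ℙ-mono A⊆B = E-mono pr (λ ω → χ-mono (A⊆B ω))

    ℙ-⊎ : ℙ p (λ ω → A ω ⊎ B ω) k ℚ.≤ ℙ p A k ℚ.+ ℙ p B k
    ℙ-⊎ = subst (ℙ p (λ ω → A ω ⊎ B ω) k ℚ.≤_)
      (E-+ (seq p k) (λ ω → χ (A ω)) (λ ω → χ (B ω))) (E-mono pr (λ ω → χ-⊎ (A ω) (B ω)))

  0≤ℙ : ∀ {N} p (A : Vec Bool N → Set) k → IsProbability (seq p k) → 0ℚ ℚ.≤ ℙ p A k
  0≤ℙ {N} p A k pr =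
    subst (ℚ._≤ ℙ p A k) (E-const N (seq p k) 0ℚ) (E-mono pr (λ ω → 0≤χ (A ω)))

  ℙ≤1 : ∀ {N} p (A : Vec Bool N → Set) k → IsProbability (seq p k) → ℙ p A k ℚ.≤ 1ℚ
  ℙ≤1 {N} p A k pr =
    subst (ℙ p A k ℚ.≤_) (E-const N (seq p k) 1ℚ) (E-mono pr (λ ω → χ≤1 (A ω)))

  ℙ-flip : ∀ {N} p p̄ k → seq p̄ k ≡ 1ℚ ℚ.- seq p k → (A : Vec Bool N → Set) →
    ℙ p̄ A k ≡ ℙ p (λ ω → A (Vec.map not ω)) k
  ℙ-flip {N} p p̄ k p̄≡1-p A = trans (cong (λ q → E q (λ ω → χ (A ω))) p̄≡1-p)
    (E-flip (seq p k) (λ ω → χ (A ω)))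

  -- Stated for failures, since these multiply over independent runs.
  ℙ-product : ∀ {M N} p k → IsProbability (seq p k) →
    (A : Vec Bool M → Set) (B : Vec Bool N → Set) (C : Vec Bool (M + N) → Set) →
    (∀ ω ω′ → A ω → C (ω Vec.++ ω′)) → (∀ ω ω′ → B ω′ → C (ω Vec.++ ω′)) →
    1ℚ ℚ.- ℙ p C k ℚ.≤ (1ℚ ℚ.- ℙ p A k) ℚ.* (1ℚ ℚ.- ℙ p B k)
  ℙ-product p k pr A B C A⇒C B⇒C = subst₂ ℚ._≤_ (complement C)
    (cong₂ ℚ._*_ (complement A) (complement B))
    (E-product pr (λ ω → 1ℚ ℚ.- χ (C ω)) (λ ω → 1ℚ ℚ.- χ (A ω)) (λ ω → 1ℚ ℚ.- χ (B ω))
      (λ ω ω′ → χ-failure (A⇒C ω ω′) (B⇒C ω ω′)))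
    where
    complement : ∀ {N} (A : Vec Bool N → Set) →
      E (seq p k) (λ ω → 1ℚ ℚ.- χ (A ω)) ≡ 1ℚ ℚ.- ℙ p A k
    complement A = E-complement (seq p k) (λ ω → χ (A ω))

  -- The listed pairs are queried in order, skipping repeats and ignoring all outcomes.
  queryAll : ∀ used es → ∃[ N ] Σ[ σ ∈ Strategy used N ] (∀ {e} → e ∈ es →
    e ∈ used ⊎ (e , true) ∈ play σ (Vec.replicate N true))
  queryAll used []       = 0 , done , λ ()
  queryAll used (e ∷ es) with em {e ∈ used}
  ... | yes e∈ = let N , σ , h = queryAll used es
                 in N , σ , λ { (here refl) → inj₁ e∈ ; (there x) → h x }
  ... | no  e∉ = let N , σ , h = queryAll (e ∷ used) es
                 in suc N , turn e e∉ (λ _ → σ) , λ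
                    { (here refl) → inj₂ (here refl)
                    ; (there x) → [ (λ { (here refl) → inj₂ (here refl) ; (there y) → inj₁ y })
                                  , inj₂ ∘ there ]′ (h x) }

  -- Amplification by independent repetition

  module _ (W : Board → Set) (W-embeds : EmbeddingClosed W) where

    Wins : ∀ {N} → Strategy [] N → Vec Bool N → Set
    Wins σ ω = W (play σ ω)

    module _ {N} (σ : Strategy [] N) where

      repeat-wins : ∀ j → Vec Bool (j * N) → Set
      repeat-wins j = Wins (repeat σ j)

      repeat-product : ∀ p k j → IsProbability (seq p k) →
        1ℚ ℚ.- ℙ p (repeat-wins (suc j)) k
        ℚ.≤ (1ℚ ℚ.- ℙ p (Wins σ) k) ℚ.* (1ℚ ℚ.- ℙ p (repeat-wins j) k)
      repeat-product p k j pr =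
        ℙ-product p k pr (Wins σ) (repeat-wins j) (repeat-wins (suc j))
          (λ ω ω′ → W-embeds even-mono (play-interleaveˡ (λ ()) (λ ()) σ (repeat σ j) ω ω′))
          (λ ω ω′ → W-embeds odd-mono (play-interleaveʳ (λ ()) (λ ()) σ (repeat σ j) ω ω′))

      repeat-failure : ∀ p c k → IsProbability (seq p k) → c ℚ.≤ ℙ p (Wins σ) k →
        ∀ j → 1ℚ ℚ.- ℙ p (repeat-wins j) k ℚ.≤ (1ℚ ℚ.- c) ^ j
      repeat-failure p c k pr c≤ zero = complement-antimono
        (0≤ℙ p (repeat-wins zero) k pr)
      repeat-failure p c k pr c≤ (suc j) = begin
        1ℚ ℚ.- ℙ p (repeat-wins (suc j)) k
          ≤⟨ repeat-product p k j pr ⟩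
        (1ℚ ℚ.- ℙ p (Wins σ) k) ℚ.* (1ℚ ℚ.- ℙ p (repeat-wins j) k)
          ≤⟨ *-monoʳ-≤ (complement-antimono (ℙ≤1 p (repeat-wins j) k pr))
                       (complement-antimono c≤) ⟩
        (1ℚ ℚ.- c) ℚ.* (1ℚ ℚ.- ℙ p (repeat-wins j) k)
          ≤⟨ *-monoˡ-≤ (complement-antimono (ℚ.≤-trans c≤ (ℙ≤1 p (Wins σ) k pr)))
               (repeat-failure p c k pr c≤ j) ⟩
        (1ℚ ℚ.- c) ^ suc j ∎
        where open ℚ.≤-Reasoning

      -- The rational `c` bounds the success of one run at all late indices, so `j` runs succeed
      -- with probability at least ½ there, with no error term.
      reaches-repeat : ∀ p c j → Eventually (λ k → IsProbability (seq p k)) →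
        Eventually (λ k → c ℚ.≤ ℙ p (Wins σ) k) → (1ℚ ℚ.- c) ^ j ℚ.≤ ½ →
        Reaches p W (j * N)
      reaches-repeat p c j pr c≤ power≤ = repeat σ j , λ ε 0<ε →
        eventually-map (λ k ½≤ → ℚ.≤-trans ½≤ (p≤p+q {ℙ p (repeat-wins j) k} {ε} (ℚ.<⇒≤ 0<ε))) ½≤ℙ
        where
        ½≤ℙ : Eventually (λ k → ½ ℚ.≤ ℙ p (repeat-wins j) k)
        ½≤ℙ = eventually-zip (λ k pr c≤ → 1-p≤½⇒½≤p {ℙ p (repeat-wins j) k}
          (ℚ.≤-trans (repeat-failure p c k pr c≤ j) power≤)) pr c≤

      -- A win on the all-true outcome has probability at least `c ^ N` at late indices, and enough
      -- repetitions raise this to ½.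
      minimum-reaches : W (play σ (Vec.replicate N true)) → ∀ p c → 0ℚ ℚ.< c →
        Eventually (λ k → c ℚ.≤ seq p k) → Eventually (λ k → IsProbability (seq p k)) →
        ∃[ a ] IsMinimum (Reaches p W) a
      minimum-reaches wins p c 0<c c≤p pr =
        let j , power≤ = power≤½ (c ^ N) (0<p^n N 0<c)
                           (proj₂ 0≤1-c^N (proj₁ 0≤1-c^N) ℕ.≤-refl)
        in minimum-exists {Reaches p W} (j * N) (reaches-repeat p (c ^ N) j pr c^N≤ power≤)
        where
        c^N≤ : Eventually (λ k → c ^ N ℚ.≤ ℙ p (Wins σ) k)
        c^N≤ = eventually-zip (λ k c≤p pr → 
          E-all-true (ℚ.<⇒≤ 0<c) c≤p pr (λ ω → χ (Wins σ ω)) (λ ω → 0≤χ (Wins σ ω))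
            (χ-true wins)) c≤p pr
        -- The inequality does not mention the index; it is derived at late indices, where `c ^ N`
        -- is below a probability, and read off at the threshold.
        0≤1-c^N : Eventually (λ k → 0ℚ ℚ.≤ 1ℚ ℚ.- c ^ N)
        0≤1-c^N = eventually-zip (λ k pr c^N≤ →
          complement-antimono (ℚ.≤-trans c^N≤ (ℙ≤1 p (Wins σ) k pr))) pr c^N≤

  -- Querying a complete graph

  complete-strategy : ∀ n → ∃[ N ] Σ[ σ ∈ Strategy [] N ]
    ContainsCopy (K n) (withOutcome true (play σ (Vec.replicate N true)))
  complete-strategy n =
    -- The product also contains the diagonal, whose junk pairs are harmless extra queries.
    let N , σ , h = queryAll [] (cartesianProductWith (λ i j → link (vertex i) (vertex j))
                                   (allFin n) (allFin n))
        board = play σ (Vec.replicate N true)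
        edge  = λ i j → h {link (vertex i) (vertex j)}
                  (∈-cartesianProductWith⁺ _ (∈-allFin i) (∈-allFin j))
    in N , σ , vertex , vertex-injective , λ i j i≢j →
      lose (∈-withOutcome⁺ {board = board} ([ (λ ()) , id ]′ (edge i j)))
           (link-joins (i≢j ∘ vertex-injective))
    where
    vertex : Fin n → ℤ
    vertex i = + toℕ i
    vertex-injective : ∀ {i j} → vertex i ≡ vertex j → i ≡ j
    vertex-injective = toℕ-injective ∘ ℤ.+-injective

  -- Comparison of the Ramsey game with the two query games

  module _ (Wᵣ Wₐ Wᵦ : Board → Set)
           (Wₐ-embeds : EmbeddingClosed Wₐ) (Wᵦ-embeds : EmbeddingClosed Wᵦ)
           (a⇒r : ∀ {b} → Wₐ b → Wᵣ b)
           (b⇒r : ∀ {b b′} → Recolours b b′ → Wᵦ b → Wᵣ b′)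
           (r⇒a⊎b : ∀ {b b′} → Recolours b b′ → Wᵣ b → Wₐ b ⊎ Wᵦ b′)
           (p p̄ : ℝ) (p̄≡1-p : ∀ k → seq p̄ k ≡ 1ℚ ℚ.- seq p k)
           (pr : Eventually (λ k → IsProbability (seq p k))) where

    reaches-a⇒r : ∀ {N} → Reaches p Wₐ N → Reaches p Wᵣ N
    reaches-a⇒r {N} a = reaches-transfer p p Wₐ Wᵣ σ σ
      (eventually-map (λ k pr → ℙ-mono p V W k pr (λ ω → a⇒r)) pr)
      (proj₂ a)
      where
      σ = proj₁ a
      V W : Vec Bool N → Set
      V ω = Wₐ (play σ ω)
      W ω = Wᵣ (play σ ω)

    reaches-b⇒r : ∀ {N} → Reaches p̄ Wᵦ N → Reaches p Wᵣ N
    reaches-b⇒r {N} a = reaches-transfer p̄ p Wᵦ Wᵣ σ (flip σ)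
      (eventually-map (λ k pr → subst (ℚ._≤ ℙ p W k) (sym (ℙ-flip p p̄ k (p̄≡1-p k) V))
        (ℙ-mono p (λ ω → V (Vec.map not ω)) W k pr flip-wins)) pr)
      (proj₂ a)
      where
      σ = proj₁ a
      V W : Vec Bool N → Set
      V ω = Wᵦ (play σ ω)
      W ω = Wᵣ (play (flip σ) ω)
      flip-wins : ∀ ω → V (Vec.map not ω) → W ω
      -- Recolouring the run on the complement of `ω` gives a run of `flip σ` on the double
      -- complement, which is `ω`.
      flip-wins ω v = subst W (map-not-involutive ω) (b⇒r (play-flip σ (Vec.map not ω)) v)

    reaches-r⇒a⊎b : ∀ {N} → Reaches p Wᵣ N →
      Reaches p Wₐ (3 * N) ⊎ Reaches p̄ Wᵦ (3 * N)
    reaches-r⇒a⊎b {N} r = [ inj₁ ∘ red , inj₂ ∘ blue ]′ (E-near p (λ ω → χ (Red ω)) ¼ δ 0<δ)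
      where
      σ = proj₁ r
      ½≤ = proj₂ r
      -- Either ℙ(Red) ≥ ¼ − δ, or ℙ(Red) ≤ ¼ + δ and then ℙ(Blue) ≥ (½ − δ) − (¼ + δ) = c.
      ¼ δ c : ℚ
      ¼ = + 1 ℚ./ 4
      δ = + 1 ℚ./ 100
      c = (¼ ℚ.- δ) ℚ.- δ
      0<δ : 0ℚ ℚ.< δ
      0<δ = from-yes (0ℚ ℚ.<? δ)
      -- Here 1 - c = 77/100, whose cube is about 0.457; its square, about 0.593, would not do.
      [1-c]³≤½ : (1ℚ ℚ.- c) ^ 3 ℚ.≤ ½
      [1-c]³≤½ = from-yes ((1ℚ ℚ.- c) ^ 3 ℚ.≤? ½)
      Either Red Blue FlippedBlue : Vec Bool N → Set
      Either      ω = Wᵣ (play σ ω)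
      Red         ω = Wₐ (play σ ω)
      FlippedBlue ω = Wᵦ (play (flip σ) ω)
      -- On complementary tosses `flip σ` produces the recoloured board of `σ`, so this is an event
      -- about the original run.
      Blue        ω = FlippedBlue (Vec.map not ω)

      red : Eventually (λ k → ¼ ℚ.- δ ℚ.≤ ℙ p Red k) → Reaches p Wₐ (3 * N)
      red ¼-δ≤ = reaches-repeat Wₐ Wₐ-embeds σ p c 3 pr
        (eventually-map (λ k → ℚ.≤-trans (from-yes (c ℚ.≤? ¼ ℚ.- δ))) ¼-δ≤) [1-c]³≤½

      blue : Eventually (λ k → ℙ p Red k ℚ.≤ ¼ ℚ.+ δ) → Reaches p̄ Wᵦ (3 * N)
      blue ≤¼+δ = reaches-repeat Wᵦ Wᵦ-embeds (flip σ) p̄ c 3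
        (eventually-map (λ k → subst IsProbability (sym (p̄≡1-p k)) ∘ isProbability-complement) pr)
        (eventually-map (λ k → subst (c ℚ.≤_) (sym (ℙ-flip p p̄ k (p̄≡1-p k) FlippedBlue))) c≤Blue)
        [1-c]³≤½
        where
        Either≤ : Eventually (λ k → ℙ p Either k ℚ.≤ ℙ p Blue k ℚ.+ (¼ ℚ.+ δ))
        Either≤ = eventually-zip (λ k pr ≤¼+δ → begin
            ℙ p Either k
              -- A union bound over the two ways to win.
              ≤⟨ ℙ-mono p Either (λ ω → Red ω ⊎ Blue ω) k pr (λ ω → r⇒a⊎b (play-flip σ ω)) ⟩
            ℙ p (λ ω → Red ω ⊎ Blue ω) k     ≤⟨ ℙ-⊎ p Red Blue k pr ⟩
            ℙ p Red k ℚ.+ ℙ p Blue k         ≤⟨ ℚ.+-monoˡ-≤ (ℙ p Blue k) ≤¼+δ ⟩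
            (¼ ℚ.+ δ) ℚ.+ ℙ p Blue k         ≡⟨ ℚ.+-comm (¼ ℚ.+ δ) (ℙ p Blue k) ⟩
            ℙ p Blue k ℚ.+ (¼ ℚ.+ δ)         ∎) pr ≤¼+δ
          where open ℚ.≤-Reasoning
        c≤Blue : Eventually (λ k → c ℚ.≤ ℙ p Blue k)
        c≤Blue = eventually-zip (λ k Either≤ ½≤ →
            -- The difference obtained, (½ - δ) - (¼ + δ), evaluates to the same rational as `c`.
            p≤q+r⇒p-r≤q {½ ℚ.- δ} {ℙ p Blue k} {¼ ℚ.+ δ}
              (ℚ.≤-trans (p≤q+r⇒p-r≤q {½} {ℙ p Either k} {δ} ½≤) Either≤))
          Either≤ (½≤ δ 0<δ)

    -- The Ramsey minimum exists because an optimal strategy for `Wₐ` also wins the Ramsey game.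
    minima : ∃[ a ] IsMinimum (Reaches p Wₐ) a → ∃[ b ] IsMinimum (Reaches p̄ Wᵦ) b →
      ∃[ r ] ∃[ a ] ∃[ b ]
        IsMinimum (Reaches p Wᵣ) r × IsMinimum (Reaches p Wₐ) a ×
        IsMinimum (Reaches p̄ Wᵦ) b × (r ≤ a ⊓ b) × (a ⊓ b ≤ 3 * r)
    minima (a , min-a) (b , min-b) =
      let module A = IsMinimum min-a
          module B = IsMinimum min-b
          r , min-r = minimum-exists {Reaches p Wᵣ} a (reaches-a⇒r A.attained)
          module R = IsMinimum min-r
      in r , a , b , min-r , min-a , min-b ,
         ℕ.⊓-glb (R.least (reaches-a⇒r A.attained)) (R.least (reaches-b⇒r B.attained)) ,
         [ (λ h → ℕ.m≤n⇒m⊓o≤n b (A.least h)) , (λ h → ℕ.m≤n⇒o⊓m≤n a (B.least h)) ]′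
           (reaches-r⇒a⊎b R.attained)

-- Specialisation to cliques

theorem10 : (em : ExcludedMiddle 0ℓ) → let open Games em in
    ∀ (m n : ℕ) → 3 ≤ m → 3 ≤ n →
    ∀ (p : ℝ) → 0ℝ <ℝ p → p <ℝ 1ℝ →
    ∃[ r ] ∃[ a ] ∃[ b ]
    (r̃⟨ m , n ⨾ p ⟩≡ r) × (f⟨ K m , p ⟩≡ a) × (f⟨ K n , 1ℝ -ℝ p ⟩≡ b) ×
    (r ≤ a ⊓ b) × (a ⊓ b ≤ 3 * r)
theorem10 em m n _ _ p (c , 0<c , 0+c≤p) (d , 0<d , p+d≤1) =
  let r , a , b , min-r , min-a , min-b , bounds =
        minima Wᵣ Wₐ Wᵦ (query-embeds (K m)) (query-embeds (K n)) inj₁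
          -- `Wᵦ` asks for a clique of outcome true, whereas the Ramsey goal wants it in outcome
          -- false; the recolouring mediates.
          (λ recolours → inj₂ ∘ containsCopy-⊆ (K n) recolours)
          (λ { recolours (inj₁ copy) → inj₁ copy
             ; recolours (inj₂ copy) → inj₂ (containsCopy-⊆ (K n) recolours copy) })
          p (1ℝ -ℝ p) (λ _ → refl) pr
          -- The margins `c` of 0 < p and `d` of p < 1 bound the edge probabilities of the two query
          -- games from below.
          (minimum-reaches Wₐ (query-embeds (K m)) σ σ-wins p c 0<c c≤p pr)
          (minimum-reaches Wᵦ (query-embeds (K n)) τ τ-wins (1ℝ -ℝ p) d 0<d d≤1-p
            (eventually-map (λ k → isProbability-complement) pr))
  in r , a , b ,
     -- Each minimum passes from `Reaches` to `Achievable`; the summands agree by computation at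
     -- every index.
     isMinimum-cong
       (λ (ρ , ½≤) → ρ , ½≤ℙ⇒½≤sum {A = λ ω → Wᵣ (play ρ ω)} (λ _ _ → refl) ½≤)
       (λ (ρ , ½≤) → ρ , ½≤sum⇒½≤ℙ {A = λ ω → Wᵣ (play ρ ω)} (λ _ _ → refl) ½≤) min-r ,
     isMinimum-cong
       (λ (ρ , ½≤) → ρ , ½≤ℙ⇒½≤sum {A = λ ω → Wₐ (play ρ ω)} (λ _ _ → refl) ½≤)
       (λ (ρ , ½≤) → ρ , ½≤sum⇒½≤ℙ {A = λ ω → Wₐ (play ρ ω)} (λ _ _ → refl) ½≤) min-a ,
     isMinimum-cong
       (λ (ρ , ½≤) → ρ , ½≤ℙ⇒½≤sum {A = λ ω → Wᵦ (play ρ ω)} (λ _ _ → refl) ½≤)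
       (λ (ρ , ½≤) → ρ , ½≤sum⇒½≤ℙ {A = λ ω → Wᵦ (play ρ ω)} (λ _ _ → refl) ½≤) min-b ,
     bounds
  where
  open Classical em
  σ = proj₁ (proj₂ (complete-strategy m))
  τ = proj₁ (proj₂ (complete-strategy n))
  σ-wins = proj₂ (proj₂ (complete-strategy m))
  τ-wins = proj₂ (proj₂ (complete-strategy n))
  Wᵣ Wₐ Wᵦ : Board → Set
  Wᵣ = Games.RamseyWin em m n
  Wₐ = Games.QueryWin em (K m)
  Wᵦ = Games.QueryWin em (K n)
  query-embeds : ∀ H → EmbeddingClosed (Games.QueryWin em H)
  query-embeds H mono sub = containsCopy-map H mono sub
  c≤p : Eventually (λ k → c ℚ.≤ seq p k)
  c≤p = eventually-map (λ k → subst (ℚ._≤ seq p k) (ℚ.+-identityˡ c)) 0+c≤p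
  d≤1-p : Eventually (λ k → d ℚ.≤ 1ℚ ℚ.- seq p k)
  d≤1-p = eventually-map (λ k p+d≤1 → q+r≤p⇒r≤p-q {1ℚ} {seq p k} {d} p+d≤1) p+d≤1
  pr : Eventually (λ k → IsProbability (seq p k))
  pr = eventually-zip (λ k c≤p d≤1-p →
    ℚ.≤-trans (ℚ.<⇒≤ 0<c) c≤p , ℚ.≤-trans (ℚ.<⇒≤ 0<d) d≤1-p) c≤p d≤1-p
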